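{- Let $\mathbf A=\langle A,\supset,\neg\rangle$ be an $I$-algebra. Then: (i) There is an embedding $h:A\to A/{\sim}\times A/{\sim}$ of $\mathbf A$ into the implicative bilattice $\mathbf B=\langle\mathbf A/{\sim}\odot\mathbf A/{\sim},\supset\rangle$ defined, for all $a\in A$, as $h(a)=\langle[a],[\neg a]\rangle$. (ii) $\mathbf B$ is generated by the set $h[A]$. (iii) If $f:A\to B'$ is a homomorphism from $\mathbf A$ to an implicative bilattice $\mathbf B'$, then there is a unique map $f':A/{\sim}\times A/{\sim}\to B'$ which is also a homomorphism from $\mathbf B$ to $\mathbf B'$ such that $f'\cdot h=f$. Moreover, if $f$ is injective, so is $f'$.
   Context: An $I$-algebra is an algebra $\langle A,\supset,\neg\rangle$ satisfying: (I1) $(x\supset x)\supset y\approx y$; (I2) $x\supset(y\supset z)\approx(x\supset y)\supset(x\supset z)\approx y\supset(x\supset z)$; (I3) $((x\supset y)\supset x)\supset x\approx x\supset x$; (I4) $x\supset(\neg y\supset z)\approx\neg(x\supset y)\supset z$; (I5) $\neg\neg x\approx x$; (I6) $p(x,y,x)\approx p(x,y,y)$, where $p(x,y,z)$ is $(x\supset y)\supset((y\supset x)\supset((\neg x\supset\neg y)\supset((\neg y\supset\neg x)\supset z)))$. For an $I$-algebra, $a\sim b$ iff $a\supset b=(a\supset b)\supset(a\supset b)$ and $b\supset a=(b\supset a)\supset(b\supset a)$; equivalently $a\supset c=b\supset c$ for all $c$. This is an equivalence relation compatible with $\supset$; $[a]$ is the class of $a$. On $A/{\sim}$ put $[a]\supset[b]=[a\supset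 b]$, $[a]\lor[b]=([a]\supset[b])\supset[b]$, $[a]\land[b]=[\neg(a\supset\neg b)]$; these are well defined and $\mathbf A/{\sim}=\langle A/{\sim},\land,\lor,\supset\rangle$ is a classical implicative lattice (a relatively complemented distributive lattice with maximum $1$, $\supset$ playing the role of the operation $a\backslash b$ = relative complement of $a$ in $[a\land b,1]$). A bilattice is an algebra $\langle B,\land,\lor,\otimes,\oplus,\neg\rangle$ such that $\langle B,\land,\lor\rangle$ and $\langle B,\otimes,\oplus\rangle$ are lattices (not necessarily bounded) with orders $\leq_t$ and $\leq_k$, and $\neg$ is unary with: $a\leq_t b\Rightarrow\neg b\leq_t\neg a$; $a\leq_k b\Rightarrow\neg a\leq_k\neg b$; $\neg\neg a=a$. An implicative bilattice is an algebra $\langle B,\land,\lor,\otimes,\oplus,\supset,\neg\rangle$ whose $\supset$-free reduct is a bilattice and which satisfies: (IB1) $(x\supset x)\supset y\approx y$; (IB2) $x\supset(y\supset z)\approx(x\land y)\supset z\approx(x\otimes y)\supset z$; (IB3) $((x\supset y)\supset x)\supset x\approx x\supset x$; (IB4) $(x\lor y)\supset z\approx(x\supset z)\land(y\supset z)\approx(x\oplus y)\supset z$; (IB5) $x\land((x\supset y)\supset(x\otimes y))\approx x$; (IB6) $\neg(x\supset y)\supset z\approx(x\land\neg y)\supset z$. For a classical implicative lattice $\mathbf L=\langle L,\sqcap,\sqcup,\backslash\rangle$, $\langle\mathbf L\odot\mathbf L,\supset\rangle$ is the implicative bilattice with universe $L\times L$ and operations $\langle a_1,a_2\rangle\land\langle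 b_1,b_2\rangle=\langle a_1\sqcap b_1,a_2\sqcup b_2\rangle$, $\langle a_1,a_2\rangle\lor\langle b_1,b_2\rangle=\langle a_1\sqcup b_1,a_2\sqcap b_2\rangle$, $\langle a_1,a_2\rangle\otimes\langle b_1,b_2\rangle=\langle a_1\sqcap b_1,a_2\sqcap b_2\rangle$, $\langle a_1,a_2\rangle\oplus\langle b_1,b_2\rangle=\langle a_1\sqcup b_1,a_2\sqcup b_2\rangle$, $\neg\langle a_1,a_2\rangle=\langle a_2,a_1\rangle$, $\langle a_1,a_2\rangle\supset\langle b_1,b_2\rangle=\langle a_1\backslash b_1,a_1\sqcap b_2\rangle$. A homomorphism (resp. embedding) from an $I$-algebra to an implicative bilattice is a map (resp. injective map) preserving $\supset$ and $\neg$; homomorphisms between implicative bilattices preserve all operations. -}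

module Defs where

open import Algebra.Core using (Op₁; Op₂)
open import Algebra.Definitions using (Congruent₁; Congruent₂)
import Algebra.Lattice.Bundles as Alg
import Algebra.Lattice.Properties.Lattice as LatticeProperties
import Algebra.Lattice.Structures as AlgStructures
open import Data.Product.Base using (_×_; _,_; proj₁; proj₂; ∃-syntax; swap)
open import Data.Product.Relation.Binary.Pointwise.NonDependent
  using (Pointwise; ×-isEquivalence)
open import Function.Definitions using (Congruent; Injective)
open import Level using (Level; suc) renaming (_⊔_ to _⊔ℓ_)
open import Relation.Binary.Core using (Rel)
open import Relation.Binary.Definitions using (Maximum)
open import Relation.Binary.Structures using (IsEquivalence)
import Relation.Binary.Construct.NaturalOrder.Left as NaturalOrder
import Relation.Binary.Lattice as Ord
import Relation.Binary.Lattice.Properties.DistributiveLattice as OrdDistributive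
import Relation.Binary.Lattice.Properties.Lattice as OrdLattice
open import Relation.Unary using (Pred)

private
  variable
    a b s ℓ ℓ′ : Level

-- All algebras are taken over setoids, so that a quotient is formed by
-- replacing the equality relation; homomorphisms are required to respect
-- equality.  Empty carriers are not excluded.

record IAlgebra (a ℓ : Level) : Set (suc (a ⊔ℓ ℓ)) where
  infix  8 ¬_
  infixr 5 _⊃_
  infix  4 _≈_
  field
    Carrier       : Set a
    _≈_           : Rel Carrier ℓ
    _⊃_           : Op₂ Carrier
    ¬_            : Op₁ Carrier
    isEquivalence : IsEquivalence _≈_
    ⊃-cong        : Congruent₂ _≈_ _⊃_
    ¬-cong        : Congruent₁ _≈_ ¬_

  p : Carrier → Carrier → Carrier → Carrier
  p x y z = (x ⊃ y) ⊃ (y ⊃ x) ⊃ (¬ x ⊃ ¬ y) ⊃ (¬ y ⊃ ¬ x) ⊃ z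

  field
    I1  : ∀ x y → (x ⊃ x) ⊃ y ≈ y
    I2ˡ : ∀ x y z → x ⊃ (y ⊃ z) ≈ (x ⊃ y) ⊃ (x ⊃ z)
    I2ʳ : ∀ x y z → (x ⊃ y) ⊃ (x ⊃ z) ≈ y ⊃ (x ⊃ z)
    I3  : ∀ x y → ((x ⊃ y) ⊃ x) ⊃ x ≈ x ⊃ x
    I4  : ∀ x y z → x ⊃ (¬ y ⊃ z) ≈ ¬ (x ⊃ y) ⊃ z
    I5  : ∀ x → ¬ ¬ x ≈ x
    I6  : ∀ x y → p x y x ≈ p x y y

  open IsEquivalence isEquivalence public

  infix 4 _∼_
  _∼_ : Rel Carrier ℓ
  x ∼ y = (x ⊃ y ≈ (x ⊃ y) ⊃ (x ⊃ y)) × (y ⊃ x ≈ (y ⊃ x) ⊃ (y ⊃ x))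

record ClassicalImplicativeLattice (a ℓ : Level) : Set (suc (a ⊔ℓ ℓ)) where
  infixr 7 _⊓_
  infixr 6 _⊔_
  infixr 5 _∖_
  infix  4 _≈_
  field
    Carrier : Set a
    _≈_     : Rel Carrier ℓ
    _⊓_     : Op₂ Carrier
    _⊔_     : Op₂ Carrier
    _∖_     : Op₂ Carrier

  open NaturalOrder _≈_ _⊓_ public using (_≤_)

  field
    isDistributiveLattice  : AlgStructures.IsDistributiveLattice _≈_ _⊔_ _⊓_
    relativelyComplemented : ∀ {x y z} → x ≤ z → z ≤ y →
                             ∃[ w ] (z ⊓ w ≈ x) × (z ⊔ w ≈ y)
    -- x ∖ y is the complement of x in [x ⊓ y , 1].  The maximum 1 is not
    -- part of the signature: it is the value of every x ⊔ (x ∖ y).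
    ∖-cong : Congruent₂ _≈_ _∖_
    ∖-meet : ∀ x y → x ⊓ (x ∖ y) ≈ x ⊓ y
    ∖-join : ∀ x y → Maximum _≤_ (x ⊔ (x ∖ y))

  open AlgStructures.IsDistributiveLattice isDistributiveLattice public

  lattice : Alg.Lattice a ℓ
  lattice = record { isLattice = isLattice }

record IsBilattice {A : Set a} (_≈_ : Rel A ℓ)
                   (_∧_ _∨_ _⊗_ _⊕_ : Op₂ A) (¬_ : Op₁ A) : Set (a ⊔ℓ ℓ) where
  open NaturalOrder _≈_ _∧_ public using () renaming (_≤_ to _≤ₜ_)
  open NaturalOrder _≈_ _⊗_ public using () renaming (_≤_ to _≤ₖ_)
  field
    isTruthLattice     : AlgStructures.IsLattice _≈_ _∨_ _∧_
    isKnowledgeLattice : AlgStructures.IsLattice _≈_ _⊕_ _⊗_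
    ¬-cong             : Congruent₁ _≈_ ¬_
    ¬-antitone-≤ₜ      : ∀ {x y} → x ≤ₜ y → (¬ y) ≤ₜ (¬ x)
    ¬-monotone-≤ₖ      : ∀ {x y} → x ≤ₖ y → (¬ x) ≤ₖ (¬ y)
    ¬-involutive       : ∀ x → (¬ (¬ x)) ≈ x

record ImplicativeBilattice (a ℓ : Level) : Set (suc (a ⊔ℓ ℓ)) where
  infix  8 ¬_
  infixr 7 _∧_ _⊗_
  infixr 6 _∨_ _⊕_
  infixr 5 _⊃_
  infix  4 _≈_
  field
    Carrier     : Set a
    _≈_         : Rel Carrier ℓ
    _∧_         : Op₂ Carrier
    _∨_         : Op₂ Carrier
    _⊗_         : Op₂ Carrier
    _⊕_         : Op₂ Carrier
    _⊃_         : Op₂ Carrier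
    ¬_          : Op₁ Carrier
    isBilattice : IsBilattice _≈_ _∧_ _∨_ _⊗_ _⊕_ ¬_
    ⊃-cong      : Congruent₂ _≈_ _⊃_
    IB1  : ∀ x y → (x ⊃ x) ⊃ y ≈ y
    IB2ˡ : ∀ x y z → x ⊃ (y ⊃ z) ≈ (x ∧ y) ⊃ z
    IB2ʳ : ∀ x y z → (x ∧ y) ⊃ z ≈ (x ⊗ y) ⊃ z
    IB3  : ∀ x y → ((x ⊃ y) ⊃ x) ⊃ x ≈ x ⊃ x
    IB4ˡ : ∀ x y z → (x ∨ y) ⊃ z ≈ (x ⊃ z) ∧ (y ⊃ z)
    IB4ʳ : ∀ x y z → (x ⊃ z) ∧ (y ⊃ z) ≈ (x ⊕ y) ⊃ z
    IB5  : ∀ x y → x ∧ ((x ⊃ y) ⊃ (x ⊗ y)) ≈ x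
    IB6  : ∀ x y z → ¬ (x ⊃ y) ⊃ z ≈ (x ∧ ¬ y) ⊃ z

  open IsBilattice isBilattice public

module Quotient (A : IAlgebra a ℓ) where
  open IAlgebra A
  private
    infix 4 ⊢_ _≼_
    ⊢_ : Carrier → Set ℓ
    ⊢ x = x ≈ x ⊃ x

    _≼_ : Rel Carrier ℓ
    x ≼ y = ⊢ x ⊃ y

  infixr 7 _∧_
  infixr 6 _∨_
  _∧_ _∨_ : Op₂ Carrier
  x ∧ y = ¬ (x ⊃ ¬ y)
  x ∨ y = (x ⊃ y) ⊃ y

  private
    ⊢-resp : ∀ {x y} → x ≈ y → ⊢ x → ⊢ y
    ⊢-resp e t = trans (sym e) (trans t (⊃-cong e e))

    ⊢-elim : ∀ {x y} → ⊢ x → x ⊃ y ≈ y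
    ⊢-elim {x} {y} t = trans (⊃-cong t refl) (I1 x y)

    mp : ∀ {x y} → ⊢ x → ⊢ x ⊃ y → ⊢ y
    mp t = ⊢-resp (⊢-elim t)

    exch : ∀ x y z → x ⊃ (y ⊃ z) ≈ y ⊃ (x ⊃ z)
    exch x y z = trans (I2ˡ x y z) (I2ʳ x y z)

    weaken : ∀ {x} y → ⊢ x → y ≼ x
    weaken {x} y t = trans (⊃-cong refl t) (I2ˡ y x x)

    ≼-refl : ∀ {x} → x ≼ x
    ≼-refl {x} = sym (I1 x (x ⊃ x))

    ≼-const : ∀ x y → x ≼ y ⊃ x
    ≼-const x y = ⊢-resp (exch y x x) (weaken y ≼-refl)

    app : ∀ {x y z} → x ≼ y ⊃ z → x ≼ y → x ≼ z
    app {x} {y} {z} f g = mp g (⊢-resp (I2ˡ x y z) f)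

    ≼-trans : ∀ {x y z} → x ≼ y → y ≼ z → x ≼ z
    ≼-trans {x} f g = app (weaken x g) f

    curry-≈ : ∀ x y z → (x ∧ y) ⊃ z ≈ x ⊃ (y ⊃ z)
    curry-≈ x y z =
      trans (sym (I4 x (¬ y) z)) (⊃-cong refl (⊃-cong (I5 y) refl))

    curry : ∀ {x y z} → x ∧ y ≼ z → x ≼ y ⊃ z
    curry {x} {y} {z} = ⊢-resp (curry-≈ x y z)

    uncurry : ∀ {x y z} → x ≼ y ⊃ z → x ∧ y ≼ z
    uncurry {x} {y} {z} = ⊢-resp (sym (curry-≈ x y z))

    flip′ : ∀ {x y z} → x ≼ y ⊃ z → y ≼ x ⊃ z
    flip′ {x} {y} {z} = ⊢-resp (exch x y z)

    π₁ : ∀ x y → x ∧ y ≼ x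
    π₁ x y = uncurry (≼-const x y)

    π₂ : ∀ x y → x ∧ y ≼ y
    π₂ x y = uncurry (weaken x ≼-refl)

    pair : ∀ {x y z} → z ≼ x → z ≼ y → z ≼ x ∧ y
    pair f g = app (≼-trans f (curry ≼-refl)) g

    ι₁ : ∀ x y → x ≼ x ∨ y
    ι₁ x y = flip′ ≼-refl

    ι₂ : ∀ x y → y ≼ x ∨ y
    ι₂ x y = ≼-const y (x ⊃ y)

    ⊃-mono : ∀ {x y u v} → y ≼ x → u ≼ v → x ⊃ u ≼ y ⊃ v
    ⊃-mono f g = curry
      (≼-trans (app (π₁ _ _) (≼-trans (π₂ _ _) f)) g)

    peirce : ∀ {x y} → (x ⊃ y) ⊃ x ≼ x
    peirce {x} {y} = ⊢-resp (sym (I3 x y)) ≼-refl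

    case : ∀ {x y z} → x ≼ z → y ≼ z → x ∨ y ≼ z
    case f g = ≼-trans (⊃-mono (⊃-mono f ≼-refl) g) peirce

  ∼-isEquivalence : IsEquivalence _∼_
  ∼-isEquivalence = record
    { refl  = ≼-refl , ≼-refl
    ; sym   = swap
    ; trans = λ (f , g) (f′ , g′) → ≼-trans f f′ , ≼-trans g′ g
    }

  private
    isOrdLattice : Ord.IsLattice _∼_ _≼_ _∨_ _∧_
    isOrdLattice = record
      { isPartialOrder = record
        { isPreorder = record
          { isEquivalence = ∼-isEquivalence
          ; reflexive     = proj₁
          ; trans         = ≼-trans
          }
        ; antisym = _,_
        }
      ; supremum = λ x y → ι₁ x y , ι₂ x y , λ _ → case
      ; infimum  = λ x y → π₁ x y , π₂ x y , λ _ → pair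
      }

    ordDistributiveLattice : Ord.DistributiveLattice a ℓ ℓ
    ordDistributiveLattice = record
      { isDistributiveLattice = record
        { isLattice    = isOrdLattice
        ; ∧-distribˡ-∨ = λ x y z →
            uncurry (flip′ (case (flip′ (curry (ι₁ _ _)))
                                 (flip′ (curry (ι₂ _ _)))))
          , case (pair (π₁ _ _) (≼-trans (π₂ _ _) (ι₁ _ _)))
                 (pair (π₁ _ _) (≼-trans (π₂ _ _) (ι₂ _ _)))
        }
      }

    module D = OrdDistributive ordDistributiveLattice

    ≼⇒≤ : ∀ {x y} → x ≼ y → x ∼ x ∧ y
    ≼⇒≤ f = pair ≼-refl f , π₁ _ _

    ≤⇒≼ : ∀ {x y} → x ∼ x ∧ y → x ≼ y
    ≤⇒≼ (f , _) = ≼-trans f (π₂ _ _)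

    excluded : ∀ x y z → z ≼ x ∨ (x ⊃ y)
    excluded x y z = weaken z (⊢-resp
      (⊃-cong (sym (trans (I2ˡ x x y) (I1 x (x ⊃ y)))) refl) ≼-refl)

    eval : ∀ {x y} → x ∧ (x ⊃ y) ≼ y
    eval = app (π₂ _ _) (π₁ _ _)

  lattice/∼ : ClassicalImplicativeLattice a ℓ
  lattice/∼ = record
    { Carrier = Carrier
    ; _≈_     = _∼_
    ; _⊓_     = _∧_
    ; _⊔_     = _∨_
    ; _∖_     = _⊃_
    ; isDistributiveLattice = record
      { isLattice   = OrdLattice.isAlgLattice
                        (Ord.DistributiveLattice.lattice ordDistributiveLattice)
      ; ∨-distrib-∧ = D.∨-distrib-∧
      ; ∧-distrib-∨ = D.∧-distrib-∨
      }
    ; relativelyComplemented = λ {x} {y} {z} x≤z z≤y →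
          (z ⊃ x) ∧ y
        , ( app (≼-trans (π₂ _ _) (π₁ _ _)) (π₁ _ _)
          , pair (≤⇒≼ x≤z)
                 (pair (≼-const _ _) (≼-trans (≤⇒≼ x≤z) (≤⇒≼ z≤y))))
        , ( case (≤⇒≼ z≤y) (π₂ _ _)
          , app (≼-trans (excluded z x y)
                  (case (curry (≼-trans (π₁ _ _) (ι₁ _ _)))
                        (curry (ι₂ _ _))))
                ≼-refl)
    ; ∖-cong = λ (f , g) (f′ , g′) → ⊃-mono g f′ , ⊃-mono f g′
    ; ∖-meet = λ x y → pair (π₁ _ _) eval
                      , pair (π₁ _ _) (≼-trans (π₂ _ _) (≼-const _ _))
    ; ∖-join = λ x y z → ≼⇒≤ (excluded x y z)
    }

infix 9 _/∼
_/∼ : IAlgebra a ℓ → ClassicalImplicativeLattice a ℓ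
A /∼ = Quotient.lattice/∼ A

module Square (L : ClassicalImplicativeLattice a ℓ) where
  open ClassicalImplicativeLattice L

  private
    open LatticeProperties lattice using (∨-∧-isOrderTheoreticLattice)
    module O = Ord.IsLattice ∨-∧-isOrderTheoreticLattice

    L² : Set a
    L² = Carrier × Carrier

  infix 4 _≈²_
  _≈²_ : Rel L² ℓ
  _≈²_ = Pointwise _≈_ _≈_

  _∧_ _∨_ _⊗_ _⊕_ _⊃_ : Op₂ L²
  (a₁ , a₂) ∧ (b₁ , b₂) = (a₁ ⊓ b₁) , (a₂ ⊔ b₂)
  (a₁ , a₂) ∨ (b₁ , b₂) = (a₁ ⊔ b₁) , (a₂ ⊓ b₂)
  (a₁ , a₂) ⊗ (b₁ , b₂) = (a₁ ⊓ b₁) , (a₂ ⊓ b₂)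
  (a₁ , a₂) ⊕ (b₁ , b₂) = (a₁ ⊔ b₁) , (a₂ ⊔ b₂)
  (a₁ , a₂) ⊃ (b₁ , b₂) = (a₁ ∖ b₁) , (a₁ ⊓ b₂)

  ¬_ : Op₁ L²
  ¬ (a₁ , a₂) = a₂ , a₁

  private
    ≤⇒join : ∀ {x y} → x ≤ y → y ≈ y ⊔ x
    ≤⇒join f = O.antisym (O.x≤x∨y _ _) (O.∨-least O.refl f)

    join⇒≤ : ∀ {x y} → y ≈ y ⊔ x → x ≤ y
    join⇒≤ e = O.trans (O.y≤x∨y _ _) (O.reflexive (sym e))

    transpose : ∀ {x y z} → z ⊓ x ≤ y → z ≤ x ∖ y
    transpose {x} {y} {z} f =
      O.trans (O.∧-greatest O.refl (∖-join x y z))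
      (O.trans (O.reflexive (∧-distribˡ-∨ z x (x ∖ y)))
      (O.∨-least
        (O.trans (O.∧-greatest (O.x∧y≤y _ _) f)
          (O.trans (O.reflexive (sym (∖-meet x y))) (O.x∧y≤y _ _)))
        (O.x∧y≤y _ _)))

    eval : ∀ {x y z} → z ≤ x → z ≤ x ∖ y → z ≤ y
    eval {x} {y} f g = O.trans (O.∧-greatest f g)
      (O.trans (O.reflexive (∖-meet x y)) (O.x∧y≤y _ _))

    l : ∀ {x y z} → x ≤ z → x ⊓ y ≤ z
    l = O.trans (O.x∧y≤x _ _)

    r : ∀ {x y z} → y ≤ z → x ⊓ y ≤ z
    r = O.trans (O.x∧y≤y _ _)

    infixr 4 _&_
    _&_ : ∀ {x y z} → z ≤ x → z ≤ y → z ≤ x ⊓ y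
    _&_ = O.∧-greatest

    ∖-refl : ∀ {x z} → z ≤ x ∖ x
    ∖-refl = transpose (r O.refl)

    ∖-unit : ∀ x y → (x ∖ x) ∖ y ≈ y
    ∖-unit x y = O.antisym (eval ∖-refl O.refl) (transpose (l O.refl))

    ∖-curry : ∀ x y z → x ∖ (y ∖ z) ≈ (x ⊓ y) ∖ z
    ∖-curry x y z = O.antisym
      (transpose (eval (r (r O.refl)) (eval (r (l O.refl)) (l O.refl))))
      (transpose (transpose (eval (l (r O.refl) & r O.refl) (l (l O.refl)))))

    peirce : ∀ x y → (x ∖ y) ∖ x ≈ x
    peirce x y = O.antisym
      (O.trans (O.refl & ∖-join x y _)
      (O.trans (O.reflexive (∧-distribˡ-∨ _ x (x ∖ y)))
      (O.∨-least (r O.refl) (eval (r O.refl) (l O.refl)))))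
      (transpose (l O.refl))

    ∖-joinˡ : ∀ x y z → (x ⊔ y) ∖ z ≈ (x ∖ z) ⊓ (y ∖ z)
    ∖-joinˡ x y z = O.antisym
      ( transpose (eval (r (O.x≤x∨y _ _)) (l O.refl))
      & transpose (eval (r (O.y≤x∨y _ _)) (l O.refl)))
      (transpose (O.trans (O.reflexive (∧-distribˡ-∨ _ x y))
        (O.∨-least (eval (r O.refl) (l (l O.refl)))
                   (eval (r O.refl) (l (r O.refl))))))

  isBilattice : IsBilattice _≈²_ _∧_ _∨_ _⊗_ _⊕_ ¬_
  isBilattice = record
    { isTruthLattice = record
      { isEquivalence = ×-isEquivalence isEquivalence isEquivalence
      ; ∨-comm     = λ _ _ → ∨-comm _ _ , ∧-comm _ _
      ; ∨-assoc    = λ _ _ _ → ∨-assoc _ _ _ , ∧-assoc _ _ _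
      ; ∨-cong     = λ (e , f) (e′ , f′) → ∨-cong e e′ , ∧-cong f f′
      ; ∧-comm     = λ _ _ → ∧-comm _ _ , ∨-comm _ _
      ; ∧-assoc    = λ _ _ _ → ∧-assoc _ _ _ , ∨-assoc _ _ _
      ; ∧-cong     = λ (e , f) (e′ , f′) → ∧-cong e e′ , ∨-cong f f′
      ; absorptive = (λ _ _ → ∨-absorbs-∧ _ _ , ∧-absorbs-∨ _ _)
                   , (λ _ _ → ∧-absorbs-∨ _ _ , ∨-absorbs-∧ _ _)
      }
    ; isKnowledgeLattice = record
      { isEquivalence = ×-isEquivalence isEquivalence isEquivalence
      ; ∨-comm     = λ _ _ → ∨-comm _ _ , ∨-comm _ _
      ; ∨-assoc    = λ _ _ _ → ∨-assoc _ _ _ , ∨-assoc _ _ _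
      ; ∨-cong     = λ (e , f) (e′ , f′) → ∨-cong e e′ , ∨-cong f f′
      ; ∧-comm     = λ _ _ → ∧-comm _ _ , ∧-comm _ _
      ; ∧-assoc    = λ _ _ _ → ∧-assoc _ _ _ , ∧-assoc _ _ _
      ; ∧-cong     = λ (e , f) (e′ , f′) → ∧-cong e e′ , ∧-cong f f′
      ; absorptive = (λ _ _ → ∨-absorbs-∧ _ _ , ∨-absorbs-∧ _ _)
                   , (λ _ _ → ∧-absorbs-∨ _ _ , ∧-absorbs-∨ _ _)
      }
    ; ¬-cong        = swap
    ; ¬-antitone-≤ₜ = λ (e , f) → join⇒≤ f , ≤⇒join e
    ; ¬-monotone-≤ₖ = swap
    ; ¬-involutive  = λ _ → refl , refl
    }

  square : ImplicativeBilattice a ℓ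
  square = record
    { Carrier     = L²
    ; _≈_         = _≈²_
    ; _∧_         = _∧_
    ; _∨_         = _∨_
    ; _⊗_         = _⊗_
    ; _⊕_         = _⊕_
    ; _⊃_         = _⊃_
    ; ¬_          = ¬_
    ; isBilattice = isBilattice
    ; ⊃-cong = λ (e , _) (e′ , f′) → ∖-cong e e′ , ∧-cong e f′
    ; IB1  = λ _ _ → ∖-unit _ _ , O.antisym (r O.refl) (∖-refl & O.refl)
    ; IB2ˡ = λ _ _ _ → ∖-curry _ _ _ , sym (∧-assoc _ _ _)
    ; IB2ʳ = λ _ _ _ → refl , refl
    ; IB3  = λ _ _ → ∖-cong (peirce _ _) refl , ∧-congʳ (peirce _ _)
    ; IB4ˡ = λ _ _ _ → ∖-joinˡ _ _ _ , ∧-distribʳ-∨ _ _ _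
    ; IB4ʳ = λ _ _ _ → sym (∖-joinˡ _ _ _) , sym (∧-distribʳ-∨ _ _ _)
    ; IB5  = λ _ _ →
        O.antisym (O.x∧y≤x _ _)
          (O.refl & transpose (l O.refl & eval (l O.refl) (r O.refl)))
      , O.antisym (O.∨-least O.refl (r (l O.refl))) (O.x≤x∨y _ _)
    ; IB6  = λ _ _ _ → refl , refl
    }

module _ (A : IAlgebra a ℓ) (B : ImplicativeBilattice b ℓ′) where
  private
    module A = IAlgebra A
    module B = ImplicativeBilattice B

  record IsIHomomorphism (f : A.Carrier → B.Carrier) : Set (a ⊔ℓ ℓ ⊔ℓ ℓ′) where
    field
      cong   : Congruent A._≈_ B._≈_ f
      ⊃-homo : ∀ x y → f (x A.⊃ y) B.≈ f x B.⊃ f y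
      ¬-homo : ∀ x → f (A.¬ x) B.≈ B.¬ f x

  record IsIEmbedding (f : A.Carrier → B.Carrier) : Set (a ⊔ℓ ℓ ⊔ℓ ℓ′) where
    field
      isIHomomorphism : IsIHomomorphism f
      injective       : Injective A._≈_ B._≈_ f

  Image : (A.Carrier → B.Carrier) → Pred B.Carrier (a ⊔ℓ ℓ′)
  Image f y = ∃[ x ] y B.≈ f x

record IsBilatticeHomomorphism
  (B : ImplicativeBilattice a ℓ) (C : ImplicativeBilattice b ℓ′)
  (f : ImplicativeBilattice.Carrier B → ImplicativeBilattice.Carrier C) :
  Set (a ⊔ℓ ℓ ⊔ℓ ℓ′) where
  private
    module B = ImplicativeBilattice B
    module C = ImplicativeBilattice C
  field
    cong   : Congruent B._≈_ C._≈_ f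
    ∧-homo : ∀ x y → f (x B.∧ y) C.≈ f x C.∧ f y
    ∨-homo : ∀ x y → f (x B.∨ y) C.≈ f x C.∨ f y
    ⊗-homo : ∀ x y → f (x B.⊗ y) C.≈ f x C.⊗ f y
    ⊕-homo : ∀ x y → f (x B.⊕ y) C.≈ f x C.⊕ f y
    ⊃-homo : ∀ x y → f (x B.⊃ y) C.≈ f x C.⊃ f y
    ¬-homo : ∀ x → f (B.¬ x) C.≈ C.¬ f x

module _ (B : ImplicativeBilattice a ℓ) where
  open ImplicativeBilattice B

  data Generated (S : Pred Carrier s) : Pred Carrier (a ⊔ℓ ℓ ⊔ℓ s) where
    incl : ∀ {x} → S x → Generated S x
    resp : ∀ {x y} → x ≈ y → Generated S x → Generated S y
    _∧ᵍ_ : ∀ {x y} → Generated S x → Generated S y → Generated S (x ∧ y)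
    _∨ᵍ_ : ∀ {x y} → Generated S x → Generated S y → Generated S (x ∨ y)
    _⊗ᵍ_ : ∀ {x y} → Generated S x → Generated S y → Generated S (x ⊗ y)
    _⊕ᵍ_ : ∀ {x y} → Generated S x → Generated S y → Generated S (x ⊕ y)
    _⊃ᵍ_ : ∀ {x y} → Generated S x → Generated S y → Generated S (x ⊃ y)
    ¬ᵍ_  : ∀ {x} → Generated S x → Generated S (¬ x)

  IsGeneratedBy : Pred Carrier s → Set (a ⊔ℓ ℓ ⊔ℓ s)
  IsGeneratedBy S = ∀ x → Generated S x

module _ (A : IAlgebra a ℓ) where
  open IAlgebra A

  𝐁 : ImplicativeBilattice a ℓ
  𝐁 = Square.square (A /∼)

  -- The carrier of A /∼ is that of A; only the equality is coarser.
  [_] : Carrier → ClassicalImplicativeLattice.Carrier (A /∼)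
  [ x ] = x

  h : Carrier → ImplicativeBilattice.Carrier 𝐁
  h x = [ x ] , [ ¬ x ]

{-# OPTIONS --safe #-}
-- The formula merge u v is chosen so that in L ⊙ L it evaluates to ⟨u₁ , v₁⟩,
-- the first coordinates of its arguments.  Hence merge (h a) (h b) = ⟨[a] , [b]⟩,
-- so h[A] generates 𝐁, and f′ ⟨[a] , [b]⟩ = merge (f a) (f b) is forced.  To see
-- that this f′ is a homomorphism it suffices that an arbitrary implicative
-- bilattice behaves like L ⊙ L: write x ≼ y when x ⊃ y is a designated element
-- and x ∼ y when x ≼ y ≼ x ("equal first coordinates").  Every operation acts on
-- first coordinates as expected, and x ∼ y together with ¬ x ∼ ¬ y forces x = y:
-- by IB5, x ≼ y gives x ≤ₜ x ⊗ y, while ¬ x ≼ ¬ y gives x ⊗ y ≤ₜ x.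

module Submission where

open import Defs
import Algebra.Lattice.Bundles as Alg
import Algebra.Lattice.Properties.Lattice as LatticeProperties
import Algebra.Lattice.Structures as AlgStructures
open import Algebra.Definitions using (Congruent₂)
open import Data.Product.Base using (_×_; _,_; proj₁; proj₂; swap; Σ-syntax)
open import Function.Base using (flip)
open import Function.Definitions using (Congruent; Injective)
open import Level using (Level)
open import Relation.Binary.Core using (Rel)
open import Relation.Binary.Bundles using (Setoid)
open import Relation.Binary.Definitions using (Antisymmetric; _Respectsˡ_; _Respectsʳ_)
open import Relation.Binary.Structures using (IsEquivalence)
import Relation.Binary.Lattice as Ord
import Relation.Binary.Lattice.Properties.JoinSemilattice as JoinProperties
import Relation.Binary.Lattice.Properties.MeetSemilattice as MeetProperties
import Relation.Binary.Reasoning.Setoid as SetoidReasoning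

private
  variable
    a b ℓ ℓ′ : Level

-- Stated for two orders so that ≤₂ can be the converse of ≤₁ (De Morgan laws).
involution-preserves-infimum :
  {A : Set a} {_≈_ : Rel A ℓ} {_≤₁_ _≤₂_ : Rel A ℓ′} {_∧₁_ _∧₂_ : A → A → A} →
  Ord.Infimum _≤₁_ _∧₁_ → Ord.Infimum _≤₂_ _∧₂_ →
  Antisymmetric _≈_ _≤₂_ → _≤₂_ Respectsˡ _≈_ → _≤₁_ Respectsʳ _≈_ →
  (φ : A → A) → (∀ x → φ (φ x) ≈ x) →
  (∀ {x y} → x ≤₁ y → φ x ≤₂ φ y) → (∀ {x y} → x ≤₂ y → φ x ≤₁ φ y) →
  ∀ x y → φ (x ∧₁ y) ≈ (φ x ∧₂ φ y)
involution-preserves-infimum {_∧₂_ = _∧₂_} inf₁ inf₂ antisym respˡ respʳ φ inv mono₁₂ mono₂₁ x y =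
  let ∧₁≤x , ∧₁≤y , ∧₁-greatest = inf₁ x y
      ∧₂≤φx , ∧₂≤φy , ∧₂-greatest = inf₂ (φ x) (φ y)
  in antisym
       (∧₂-greatest _ (mono₁₂ ∧₁≤x) (mono₁₂ ∧₁≤y))
       -- `φ` sends `φ x ∧₂ φ y` below both `x` and `y`, hence below `x ∧₁ y`; applying `φ` again
       -- and cancelling gives the other inequality.
       (respˡ (inv (φ x ∧₂ φ y)) (mono₁₂ (∧₁-greatest _
         (respʳ (inv x) (mono₂₁ ∧₂≤φx))
         (respʳ (inv y) (mono₂₁ ∧₂≤φy)))))

module ImplicativeBilatticeProperties (B : ImplicativeBilattice a ℓ) where
  open ImplicativeBilattice B

  module T = AlgStructures.IsLattice isTruthLattice
  module K = AlgStructures.IsLattice isKnowledgeLattice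
  open IsEquivalence T.isEquivalence public using (refl; sym; trans)

  setoid : Setoid a ℓ
  setoid = record { isEquivalence = T.isEquivalence }

  truthLattice knowledgeLattice : Alg.Lattice a ℓ
  truthLattice     = record { isLattice = isTruthLattice }
  knowledgeLattice = record { isLattice = isKnowledgeLattice }

  module ≤ₜ = Ord.IsLattice
    (LatticeProperties.∨-∧-isOrderTheoreticLattice truthLattice)
  module ≤ₖ = Ord.IsLattice
    (LatticeProperties.∨-∧-isOrderTheoreticLattice knowledgeLattice)

  -- Negation and the four lattice operations.

  ¬-∧ : ∀ x y → ¬ (x ∧ y) ≈ ¬ x ∨ ¬ y
  ¬-∧ = involution-preserves-infimum {_≤₂_ = flip _≤ₜ_} ≤ₜ.infimum ≤ₜ.supremum
    (flip ≤ₜ.antisym) ≤ₜ.≤-respʳ-≈ ≤ₜ.≤-respʳ-≈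
    ¬_ ¬-involutive ¬-antitone-≤ₜ ¬-antitone-≤ₜ

  ¬-∨ : ∀ x y → ¬ (x ∨ y) ≈ ¬ x ∧ ¬ y
  ¬-∨ = involution-preserves-infimum {_≤₁_ = flip _≤ₜ_} ≤ₜ.supremum ≤ₜ.infimum
    ≤ₜ.antisym ≤ₜ.≤-respˡ-≈ ≤ₜ.≤-respˡ-≈
    ¬_ ¬-involutive ¬-antitone-≤ₜ ¬-antitone-≤ₜ

  ¬-⊗ : ∀ x y → ¬ (x ⊗ y) ≈ ¬ x ⊗ ¬ y
  ¬-⊗ = involution-preserves-infimum ≤ₖ.infimum ≤ₖ.infimum
    ≤ₖ.antisym ≤ₖ.≤-respˡ-≈ ≤ₖ.≤-respʳ-≈
    ¬_ ¬-involutive ¬-monotone-≤ₖ ¬-monotone-≤ₖ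

  ¬-⊕ : ∀ x y → ¬ (x ⊕ y) ≈ ¬ x ⊕ ¬ y
  ¬-⊕ = involution-preserves-infimum {_≤₁_ = flip _≤ₖ_} {_≤₂_ = flip _≤ₖ_}
    ≤ₖ.supremum ≤ₖ.supremum
    (flip ≤ₖ.antisym) ≤ₖ.≤-respʳ-≈ ≤ₖ.≤-respˡ-≈
    ¬_ ¬-involutive ¬-monotone-≤ₖ ¬-monotone-≤ₖ

  -- Designated elements and the implication preorder.

  infix 4 ⊢_ _≼_ _∼_
  ⊢_ : Carrier → Set ℓ
  ⊢ x = x ≈ x ⊃ x

  _≼_ _∼_ : Rel Carrier ℓ
  x ≼ y = ⊢ x ⊃ y
  x ∼ y = x ≼ y × y ≼ x

  ⊢-resp : ∀ {x y} → x ≈ y → ⊢ x → ⊢ y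
  ⊢-resp e t = trans (sym e) (trans t (⊃-cong e e))

  ⊢-elim : ∀ {x y} → ⊢ x → x ⊃ y ≈ y
  ⊢-elim t = trans (⊃-cong t refl) (IB1 _ _)

  ≼-refl : ∀ {x} → x ≼ x
  ≼-refl = sym (IB1 _ _)

  ⊃-antitone-≤ₜ : ∀ {x y z} → x ≤ₜ y → y ⊃ z ≤ₜ x ⊃ z
  ⊃-antitone-≤ₜ {x} {y} {z} x≤y = ≤ₜ.≤-respˡ-≈
    (trans (sym (IB4ˡ x y z))
           (⊃-cong (≤ₜ.antisym (≤ₜ.∨-least x≤y ≤ₜ.refl) (≤ₜ.y≤x∨y x y)) refl))
    (≤ₜ.x∧y≤x (x ⊃ z) (y ⊃ z))

  -- IB4 sends `⊕` in an antecedent to a truth meet, so a hypothesis about `≤ₖ` yields a conclusion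
  -- about `≤ₜ`.
  ⊃-antitone-≤ₖ : ∀ {x y z} → x ≤ₖ y → y ⊃ z ≤ₜ x ⊃ z
  ⊃-antitone-≤ₖ {x} {y} {z} x≤y = ≤ₜ.≤-respˡ-≈
    (trans (IB4ʳ x y z)
           (⊃-cong (≤ₖ.antisym (≤ₖ.∨-least x≤y ≤ₖ.refl) (≤ₖ.y≤x∨y x y)) refl))
    (≤ₜ.x∧y≤x (x ⊃ z) (y ⊃ z))

  -- `y ∧ (y ⊃ y)` lies below `y ⊃ y`. As antecedents of `x` these give `y ⊃ x` and `x`, by IB2 and
  -- IB1.
  x≤y⊃x : ∀ x y → x ≤ₜ y ⊃ x
  x≤y⊃x x y = ≤ₜ.≤-respʳ-≈
    (trans (sym (IB2ˡ y (y ⊃ y) x)) (⊃-cong refl (IB1 y x)))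
    (≤ₜ.≤-respˡ-≈ (IB1 y x) (⊃-antitone-≤ₜ (≤ₜ.x∧y≤y y (y ⊃ y))))

  ⊢-upward : ∀ {x y} → ⊢ x → x ≤ₜ y → ⊢ y
  ⊢-upward t x≤y = ≤ₜ.antisym (x≤y⊃x _ _) (≤ₜ.≤-respʳ-≈ (⊢-elim t) (⊃-antitone-≤ₜ x≤y))

  weaken : ∀ {x} y → ⊢ x → y ≼ x
  weaken y t = ⊢-upward t (x≤y⊃x _ y)

  x≤x⊗y : ∀ {x y} → x ≼ y → x ≤ₜ x ⊗ y
  x≤x⊗y {x} {y} x≼y = ≤ₜ.≤-respʳ-≈ (⊢-elim x≼y) (sym (IB5 x y))

  -- IB2 makes the left side `(x ⊗ y) ⊃ z`, and antitonicity in each order bounds it from one side: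
  -- `x ≤ₜ x ⊗ y` comes from IB5, while `x ⊗ y ≤ₖ x` always holds. Transitivity of `≼` and the meet
  -- property of `∧` both rest on this.
  ⊃-absorb : ∀ {x y z} → x ≼ y → x ⊃ (y ⊃ z) ≈ x ⊃ z
  ⊃-absorb {x} {y} {z} x≼y =
    trans (trans (IB2ˡ x y z) (IB2ʳ x y z))
          (≤ₜ.antisym (⊃-antitone-≤ₜ (x≤x⊗y x≼y)) (⊃-antitone-≤ₖ (≤ₖ.x∧y≤x x y)))

  ≼-trans : ∀ {x y z} → x ≼ y → y ≼ z → x ≼ z
  ≼-trans {x} f g = ⊢-resp (⊃-absorb f) (weaken x g)

  ∼-isEquivalence : IsEquivalence _∼_
  ∼-isEquivalence = record
    { refl  = ≼-refl , ≼-refl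
    ; sym   = swap
    ; trans = λ (f , g) (f′ , g′) → ≼-trans f f′ , ≼-trans g′ g
    }

  open IsEquivalence ∼-isEquivalence public using ()
    renaming (sym to ∼-sym; trans to ∼-trans)

  ≈⇒∼ : ∀ {x y} → x ≈ y → x ∼ y
  ≈⇒∼ e = ⊢-resp (⊃-cong refl e) ≼-refl , ⊢-resp (⊃-cong e refl) ≼-refl

  -- It suffices to take `z` to be `y` and `x`. This turns IB2, IB4 and IB6, which only compare
  -- antecedents, into facts about `∼`.
  ⊃-injectiveˡ : ∀ {x y} → (∀ z → x ⊃ z ≈ y ⊃ z) → x ∼ y
  ⊃-injectiveˡ e = ⊢-resp (sym (e _)) ≼-refl , ⊢-resp (e _) ≼-refl

  ≤ₜ⇒≼ : ∀ {x y} → x ≤ₜ y → x ≼ y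
  ≤ₜ⇒≼ {x} {y} x≤y = ⊢-resp
    (trans (IB2ˡ x y y) (⊃-cong (sym x≤y) refl)) (weaken x ≼-refl)

  ≼-curry : ∀ {x y z} → x ∧ y ≼ z → x ≼ y ⊃ z
  ≼-curry = ⊢-resp (sym (IB2ˡ _ _ _))

  ≼-uncurry : ∀ {x y z} → x ≼ y ⊃ z → x ∧ y ≼ z
  ≼-uncurry = ⊢-resp (IB2ˡ _ _ _)

  -- Absorbing the antecedents `x` and `y` of the designated `z ⊃ (x ⊃ (y ⊃ x ∧ y))` leaves
  -- `z ⊃ x ∧ y`.
  ∧-greatest : ∀ {x y z} → z ≼ x → z ≼ y → z ≼ x ∧ y
  ∧-greatest {z = z} f g = ⊢-resp (trans (⊃-absorb f) (⊃-absorb g))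
    (weaken z (≼-curry ≼-refl))

  ⊢-∧ : ∀ {x y} → ⊢ x → ⊢ y → ⊢ x ∧ y
  ⊢-∧ s t = sym (trans (sym (IB2ˡ _ _ _)) (trans (⊢-elim s) (⊢-elim t)))

  ∨-least : ∀ {x y z} → x ≼ z → y ≼ z → x ∨ y ≼ z
  ∨-least f g = ⊢-resp (sym (IB4ˡ _ _ _)) (⊢-∧ f g)

  ≼-isLattice : Ord.IsLattice _∼_ _≼_ _∨_ _∧_
  ≼-isLattice = record
    { isPartialOrder = record
      { isPreorder = record
        { isEquivalence = ∼-isEquivalence
        ; reflexive     = proj₁
        ; trans         = ≼-trans
        }
      ; antisym = _,_
      }
    ; supremum = λ x y → ≤ₜ⇒≼ (≤ₜ.x≤x∨y x y) , ≤ₜ⇒≼ (≤ₜ.y≤x∨y x y) , λ _ → ∨-least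
    ; infimum  = λ x y → ≤ₜ⇒≼ (≤ₜ.x∧y≤x x y) , ≤ₜ⇒≼ (≤ₜ.x∧y≤y x y) , λ _ → ∧-greatest
    }

  open Ord.IsLattice ≼-isLattice public using ()
    renaming (x≤x∨y to x≼x∨y; y≤x∨y to y≼x∨y; x∧y≤x to x∧y≼x)

  ≼-lattice : Ord.Lattice a ℓ ℓ
  ≼-lattice = record { isLattice = ≼-isLattice }

  open MeetProperties (Ord.Lattice.meetSemilattice ≼-lattice) public
    using () renaming (∧-monotonic to ∧-mono-≼; ∧-cong to ∧-cong-∼)
  open JoinProperties (Ord.Lattice.joinSemilattice ≼-lattice) public
    using () renaming (∨-cong to ∨-cong-∼)

  -- The operations modulo `∼`.

  ⊗∼∧ : ∀ x y → x ⊗ y ∼ x ∧ y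
  ⊗∼∧ x y = ⊃-injectiveˡ λ z → sym (IB2ʳ x y z)

  ⊕∼∨ : ∀ x y → x ⊕ y ∼ x ∨ y
  ⊕∼∨ x y = ⊃-injectiveˡ λ z → sym (trans (IB4ˡ x y z) (IB4ʳ x y z))

  ¬⊃∼∧¬ : ∀ x y → ¬ (x ⊃ y) ∼ x ∧ ¬ y
  ¬⊃∼∧¬ x y = ⊃-injectiveˡ (IB6 x y)

  ⊃-mono-≼ : ∀ {x y u v} → y ≼ x → u ≼ v → x ⊃ u ≼ y ⊃ v
  ⊃-mono-≼ y≼x u≼v = ≼-curry
    (≼-trans (∧-mono-≼ ≼-refl y≼x) (≼-trans (≼-uncurry ≼-refl) u≼v))

  ⊃-cong-∼ : ∀ {x y u v} → x ∼ y → u ∼ v → x ⊃ u ∼ y ⊃ v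
  ⊃-cong-∼ (f , g) (f′ , g′) = ⊃-mono-≼ g f′ , ⊃-mono-≼ f g′

  ¬⊃¬∼∧ : ∀ x y → ¬ (x ⊃ ¬ y) ∼ x ∧ y
  ¬⊃¬∼∧ x y = ∼-trans (¬⊃∼∧¬ x (¬ y)) (≈⇒∼ (T.∧-congˡ (¬-involutive y)))

  -- Needed because joins in `A /∼` are defined by the term on the left. Enlarging `x` and the outer
  -- `y` to `s = x ∨ y` gives `(s ⊃ y) ⊃ s`, which is below `s` by Peirce's law IB3.
  ⊃⊃∼∨ : ∀ x y → (x ⊃ y) ⊃ y ∼ x ∨ y
  ⊃⊃∼∨ x y =
      ≼-trans (⊃-mono-≼ (⊃-mono-≼ (x≼x∨y x y) ≼-refl) (y≼x∨y x y))
              (⊢-resp (sym (IB3 (x ∨ y) y)) ≼-refl)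
    , ∨-least (≼-curry (≼-trans (proj₁ (≈⇒∼ (T.∧-comm x (x ⊃ y)))) (≼-uncurry ≼-refl)))
              (≼-curry (x∧y≼x y (x ⊃ y)))

  -- Elements determined by two coordinates.

  ∼-separates : ∀ {x y} → x ∼ y → ¬ x ∼ ¬ y → x ≈ y
  ∼-separates (x≼y , y≼x) (¬x≼¬y , ¬y≼¬x) =
    trans (x≈x⊗y x≼y ¬x≼¬y) (trans (K.∧-comm _ _) (sym (x≈x⊗y y≼x ¬y≼¬x)))
    where
    x≈x⊗y : ∀ {x y} → x ≼ y → ¬ x ≼ ¬ y → x ≈ x ⊗ y
    x≈x⊗y {x} {y} f g = ≤ₜ.antisym (x≤x⊗y f)
      -- IB5 on negations gives `¬ x ≤ₜ ¬ x ⊗ ¬ y`; `¬` commutes with `⊗` but reverses `≤ₜ`.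
      (≤ₜ.≤-respˡ-≈ (trans (¬-cong (sym (¬-⊗ x y))) (¬-involutive (x ⊗ y)))
        (≤ₜ.≤-respʳ-≈ (¬-involutive x) (¬-antitone-≤ₜ (x≤x⊗y g))))

  -- In L ⊙ L this is ⟨a₁ , 1⟩ for x = ⟨a₁ , a₂⟩.
  saturate : Carrier → Carrier
  saturate x = x ⊕ ¬ (x ⊃ x)

  merge : Carrier → Carrier → Carrier
  merge x y = saturate x ⊗ ¬ saturate y

  saturate-∼ : ∀ x → saturate x ∼ x
  saturate-∼ x = ∼-trans (⊕∼∨ x (¬ (x ⊃ x)))
    ( ∨-least ≼-refl (≼-trans (proj₁ (¬⊃∼∧¬ x x)) (x∧y≼x x (¬ x)))
    , x≼x∨y x _)

  -- Negation turns the joinand `¬ (x ⊃ x)` of `saturate x` into the designated `x ⊃ x`. This lets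
  -- `¬ saturate y` drop out of the first coordinate of `merge x y`.
  ⊢¬saturate : ∀ x → ⊢ ¬ saturate x
  ⊢¬saturate x = ⊢-resp (⊢-elim ≼-refl) (≼-trans
    (≼-trans (proj₂ (≈⇒∼ (¬-involutive (x ⊃ x)))) (y≼x∨y (¬ x) _))
    (≼-trans (proj₂ (⊕∼∨ (¬ x) _)) (proj₂ (≈⇒∼ (¬-⊕ x _)))))

  ¬-merge : ∀ x y → ¬ merge x y ≈ merge y x
  ¬-merge x y = begin
    ¬ (saturate x ⊗ ¬ saturate y)    ≈⟨ ¬-⊗ _ _ ⟩
    ¬ saturate x ⊗ ¬ ¬ saturate y    ≈⟨ K.∧-comm _ _ ⟩
    ¬ ¬ saturate y ⊗ ¬ saturate x    ≈⟨ K.∧-congʳ (¬-involutive _) ⟩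
    saturate y ⊗ ¬ saturate x        ∎
    where open SetoidReasoning setoid

  merge-∼ : ∀ x y → merge x y ∼ x
  merge-∼ x y = ∼-trans (⊗∼∧ (saturate x) (¬ saturate y))
    ( ≼-trans (x∧y≼x _ _) (proj₁ (saturate-∼ x))
    , ∧-greatest (proj₂ (saturate-∼ x)) (weaken x (⊢¬saturate y)))

  ¬merge-∼ : ∀ x y → ¬ merge x y ∼ y
  ¬merge-∼ x y = ∼-trans (≈⇒∼ (¬-merge x y)) (merge-∼ y x)

  -- An element is fixed by its two coordinates, so an equation with a `merge` on one side reduces
  -- to a pair of `∼` facts.
  merge-unique : ∀ {x y z} → z ∼ x → ¬ z ∼ y → merge x y ≈ z
  merge-unique {x} {y} z∼x ¬z∼y = ∼-separates
    (∼-trans (merge-∼ x y) (∼-sym z∼x)) (∼-trans (¬merge-∼ x y) (∼-sym ¬z∼y))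

  merge-cong : Congruent₂ _≈_ merge
  merge-cong e f = K.∧-cong (saturate-cong e) (¬-cong (saturate-cong f))
    where
    saturate-cong : Congruent _≈_ _≈_ saturate
    saturate-cong e = K.∨-cong e (¬-cong (⊃-cong e e))

-- The embedding of an I-algebra into its square.

module IAlgebraProperties (A : IAlgebra a ℓ) where
  open IAlgebra A

  ≈⇒∼ : ∀ {x y} → x ≈ y → x ∼ y
  ≈⇒∼ {x} {y} e =
      trans (⊃-cong e refl) (trans (⊢yy y) (⊃-cong x⊃y x⊃y))
    , trans (⊃-cong refl e) (trans (⊢yy y) (⊃-cong y⊃x y⊃x))
    where
    ⊢yy : ∀ y → y ⊃ y ≈ (y ⊃ y) ⊃ (y ⊃ y)
    ⊢yy y = sym (I1 y (y ⊃ y))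
    x⊃y = ⊃-cong (sym e) refl
    y⊃x = ⊃-cong refl (sym e)

  -- The four halves of the hypotheses discharge the four antecedents of `p x y z`, leaving `z`; I6
  -- then reads `x ≈ y`.
  ∼-separates : ∀ {x y} → x ∼ y → ¬ x ∼ ¬ y → x ≈ y
  ∼-separates {x} {y} (f , g) (f′ , g′) =
    trans (sym (p-elim x)) (trans (I6 x y) (p-elim y))
    where
    ⊢-elim : ∀ {x y} → x ≈ x ⊃ x → x ⊃ y ≈ y
    ⊢-elim t = trans (⊃-cong t refl) (I1 _ _)

    p-elim : ∀ z → p x y z ≈ z
    p-elim z = trans (⊢-elim f) (trans (⊢-elim g) (trans (⊢-elim f′) (⊢-elim g′)))

h-isIEmbedding : (A : IAlgebra a ℓ) → IsIEmbedding A (𝐁 A) (h A)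
h-isIEmbedding A = record
  { isIHomomorphism = record
    { cong   = λ e → ≈⇒∼ e , ≈⇒∼ (¬-cong e)
    ; ⊃-homo = λ x y → ≈⇒∼ refl
                      -- The second coordinate in `𝐁 A` is the meet `¬ (x ⊃ ¬ ¬ y)`, which I5
                      -- matches with `¬ (x ⊃ y)`.
                      , ≈⇒∼ (¬-cong (⊃-cong refl (sym (I5 y))))
    ; ¬-homo = λ x → ≈⇒∼ refl , ≈⇒∼ (I5 x)
    }
  ; injective = λ (e , f) → ∼-separates e f
  }
  where
  open IAlgebra A
  open IAlgebraProperties A

-- Generation by the image of `h`.

module _ (A : IAlgebra a ℓ) where
  private
    module B = ImplicativeBilattice (𝐁 A)
    module P = ImplicativeBilatticeProperties (𝐁 A)

  -- (x , y) ⊃ w does not depend on y, so both hypotheses of merge-unique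
  -- are instances of reflexivity.
  merge-h : ∀ x y → P.merge (h A x) (h A y) B.≈ (x , y)
  merge-h x y = P.merge-unique {h A x} {h A y} {x , y}
    (P.≼-refl {h A x} , P.≼-refl {x , y}) (P.≼-refl {h A y} , P.≼-refl {y , x})

  h-generates : IsGeneratedBy (𝐁 A) (Image A (𝐁 A) (h A))
  h-generates (x , y) = resp (merge-h x y) (saturateᵍ x ⊗ᵍ (¬ᵍ saturateᵍ y))
    where
    saturateᵍ : ∀ x → Generated (𝐁 A) (Image A (𝐁 A) (h A)) (P.saturate (h A x))
    saturateᵍ x = hx ⊕ᵍ (¬ᵍ (hx ⊃ᵍ hx))
      where hx = incl (x , P.refl {h A x})

-- The universal property of the square.

module _ (A : IAlgebra a ℓ) (C : ImplicativeBilattice b ℓ′)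
         (f : IAlgebra.Carrier A → ImplicativeBilattice.Carrier C)
         (f-hom : IsIHomomorphism A C f) where
  private
    module A = IAlgebra A
    module B = ImplicativeBilattice (𝐁 A)
    module P = ImplicativeBilatticeProperties (𝐁 A)
    module F = IsIHomomorphism f-hom
  open ImplicativeBilattice C
  open ImplicativeBilatticeProperties C

  extension : B.Carrier → Carrier
  extension (x , y) = merge (f x) (f y)

  private
    ⊢-homo : ∀ {x} → x A.≈ x A.⊃ x → ⊢ f x
    ⊢-homo t = trans (F.cong t) (F.⊃-homo _ _)

    ∼-homo : ∀ {x y} → x A.∼ y → f x ∼ f y
    ∼-homo (s , t) = ⊢-resp (F.⊃-homo _ _) (⊢-homo s) , ⊢-resp (F.⊃-homo _ _) (⊢-homo t)

    ∧-homo-∼ : ∀ x y → f x ∧ f y ∼ f (A.¬ (x A.⊃ A.¬ y))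
    ∧-homo-∼ x y = ∼-sym (∼-trans
      (≈⇒∼ (trans (F.¬-homo _) (¬-cong (trans (F.⊃-homo _ _) (⊃-cong refl (F.¬-homo _))))))
      (¬⊃¬∼∧ (f x) (f y)))

    ∨-homo-∼ : ∀ x y → f x ∨ f y ∼ f ((x A.⊃ y) A.⊃ y)
    ∨-homo-∼ x y = ∼-sym (∼-trans
      (≈⇒∼ (trans (F.⊃-homo _ _) (⊃-cong (F.⊃-homo _ _) refl)))
      (⊃⊃∼∨ (f x) (f y)))

    fst : ∀ p → extension p ∼ f (proj₁ p)
    fst (x , y) = merge-∼ (f x) (f y)

    snd : ∀ p → ¬ extension p ∼ f (proj₂ p)
    snd (x , y) = ¬merge-∼ (f x) (f y)

    ∧₁ : ∀ {u v x y} → u ∼ f x → v ∼ f y → u ∧ v ∼ f (A.¬ (x A.⊃ A.¬ y))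
    ∧₁ s t = ∼-trans (∧-cong-∼ s t) (∧-homo-∼ _ _)

    ∨₁ : ∀ {u v x y} → u ∼ f x → v ∼ f y → u ∨ v ∼ f ((x A.⊃ y) A.⊃ y)
    ∨₁ s t = ∼-trans (∨-cong-∼ s t) (∨-homo-∼ _ _)

  extension-isBilatticeHomomorphism : IsBilatticeHomomorphism (𝐁 A) C extension
  extension-isBilatticeHomomorphism = record
    { cong   = λ {p} {q} (s , t) → merge-unique
        (∼-trans (fst q) (∼-sym (∼-homo s)))
        (∼-trans (snd q) (∼-sym (∼-homo t)))
    ; ∧-homo = λ p q → merge-unique
        (∧₁ (fst p) (fst q))
        (∼-trans (≈⇒∼ (¬-∧ _ _)) (∨₁ (snd p) (snd q)))
    ; ∨-homo = λ p q → merge-unique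
        (∨₁ (fst p) (fst q))
        (∼-trans (≈⇒∼ (¬-∨ _ _)) (∧₁ (snd p) (snd q)))
    ; ⊗-homo = λ p q → merge-unique
        (∼-trans (⊗∼∧ _ _) (∧₁ (fst p) (fst q)))
        (∼-trans (≈⇒∼ (¬-⊗ _ _)) (∼-trans (⊗∼∧ _ _) (∧₁ (snd p) (snd q))))
    ; ⊕-homo = λ p q → merge-unique
        (∼-trans (⊕∼∨ _ _) (∨₁ (fst p) (fst q)))
        (∼-trans (≈⇒∼ (¬-⊕ _ _)) (∼-trans (⊕∼∨ _ _) (∨₁ (snd p) (snd q))))
    ; ⊃-homo = λ p q → merge-unique
        (∼-trans (⊃-cong-∼ (fst p) (fst q)) (≈⇒∼ (sym (F.⊃-homo _ _))))
        -- The second coordinate of an implication mixes the two: it is the meet of the first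
        -- coordinate of `p` with the second of `q`.
        (∼-trans (¬⊃∼∧¬ _ _) (∧₁ (fst p) (snd q)))
    ; ¬-homo = λ (x , y) → sym (¬-merge (f x) (f y))
    }

  extension-h : ∀ x → extension (h A x) ≈ f x
  extension-h x = merge-unique (≈⇒∼ refl) (≈⇒∼ (sym (F.¬-homo x)))

  extension-unique : ∀ g → IsBilatticeHomomorphism (𝐁 A) C g →
                     (∀ x → g (h A x) ≈ f x) → ∀ p → g p ≈ extension p
  extension-unique g g-hom g-h (x , y) = begin
    g (x , y)                           ≈⟨ G.cong (merge-h A x y) ⟨
    g (P.merge (h A x) (h A y))         ≈⟨ merge-homo (h A x) (h A y) ⟩
    merge (g (h A x)) (g (h A y))       ≈⟨ merge-cong (g-h x) (g-h y) ⟩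
    merge (f x) (f y)                   ∎
    where
    open SetoidReasoning setoid
    module G = IsBilatticeHomomorphism g-hom

    saturate-homo : ∀ p → g (P.saturate p) ≈ saturate (g p)
    saturate-homo p = trans (G.⊕-homo _ _)
      (K.∨-congˡ (trans (G.¬-homo _) (¬-cong (G.⊃-homo p p))))

    merge-homo : ∀ p q → g (P.merge p q) ≈ merge (g p) (g q)
    merge-homo p q = trans (G.⊗-homo _ _)
      (K.∧-cong (saturate-homo p) (trans (G.¬-homo _) (¬-cong (saturate-homo q))))

  -- Designation is an equation in `⊃`, so an injective `f` reflects it and hence `∼`; the
  -- coordinates of `p` and `q` can then be compared inside `C`.
  extension-injective : Injective A._≈_ _≈_ f → Injective B._≈_ _≈_ extension
  extension-injective f-inj {p} {q} e =
      ∼-reflects (∼-trans (∼-sym (fst p)) (∼-trans (≈⇒∼ e) (fst q)))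
    , ∼-reflects (∼-trans (∼-sym (snd p)) (∼-trans (≈⇒∼ (¬-cong e)) (snd q)))
    where
    ⊢-reflects : ∀ {x} → ⊢ f x → x A.≈ x A.⊃ x
    ⊢-reflects t = f-inj (trans t (sym (F.⊃-homo _ _)))

    ∼-reflects : ∀ {x y} → f x ∼ f y → x A.∼ y
    ∼-reflects (s , t) =
        ⊢-reflects (⊢-resp (sym (F.⊃-homo _ _)) s)
      , ⊢-reflects (⊢-resp (sym (F.⊃-homo _ _)) t)

theorem5p5p7 : ∀ {a ℓ b ℓ′} (A : IAlgebra a ℓ) →
    IsIEmbedding A (𝐁 A) (h A)
  × IsGeneratedBy (𝐁 A) (Image A (𝐁 A) (h A))
  × (∀ (B′ : ImplicativeBilattice b ℓ′) →
     let module A  = IAlgebra A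
         module B  = ImplicativeBilattice (𝐁 A)
         module B′ = ImplicativeBilattice B′
     in
     (f : A.Carrier → B′.Carrier) → IsIHomomorphism A B′ f →
     Σ[ f′ ∈ (B.Carrier → B′.Carrier) ]
         IsBilatticeHomomorphism (𝐁 A) B′ f′
       × (∀ x → f′ (h A x) B′.≈ f x)
       × (∀ (g : B.Carrier → B′.Carrier) →
          IsBilatticeHomomorphism (𝐁 A) B′ g →
          (∀ x → g (h A x) B′.≈ f x) →
          ∀ y → g y B′.≈ f′ y)
       × (Injective A._≈_ B′._≈_ f → Injective B._≈_ B′._≈_ f′))
theorem5p5p7 A =
    h-isIEmbedding A
  , h-generates A
  , λ C f f-hom →
        extension A C f f-hom
      , extension-isBilatticeHomomorphism A C f f-hom
      , extension-h A C f f-hom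
      , extension-unique A C f f-hom
      , extension-injective A C f f-hom
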